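{- Let $G$ be a graph, let $l$ be an intersecting supermodular subadditive integer-valued function on subsets of $V(G)$, and let $\ell$ be a $2$-intersecting supermodular subadditive integer-valued function on subsets of $V(G)$. Let $F$ and $\mathcal{F}$ be two edge-disjoint spanning subgraphs of $G$ such that $F$ is $l$-sparse and $\mathcal{F}$ is $\ell$-sparse, and such that $|E(F\cup\mathcal{F})|$ is maximum among all such pairs. Then there is a partition $P$ of $V(G)$ with the following properties: (1) for every $A\in P$, the graph $F[A]$ is $l$-partition-connected; (2) no edge of $E(G)\setminus E(F\cup\mathcal{F})$ joins different parts of $P$; (3) for every $xy\in E(G)\setminus E(\mathcal{F})$ with $x,y\in A\in P$, there is a vertex set $X$ with $\{x,y\}\subseteq X\subseteq A$ such that $\mathcal{F}[X]$ is $\ell$-rigid.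
   Context: Graphs are finite, loopless, multiple edges allowed. $e_H(X)$ is the number of edges of $H$ with both ends in $X$; for a partition $P$, $e_H(P)$ is the number of edges joining different parts. Set functions are zero on $\emptyset$, $f(v)=f(\{v\})$. $f$ is $c$-intersecting supermodular if $f(A\cap B)+f(A\cup B)\ge f(A)+f(B)$ whenever $|A\cap B|\ge c$ (intersecting means $c=1$); subadditive if $f(A)+f(B)\ge f(A\cup B)$ for disjoint $A,B$. A spanning subgraph $F$ is $f$-sparse if $e_F(X)\le\sum_{v\in X}f(v)-f(X)$ for all $X$. A graph $H$ is $f$-rigid if it has a spanning $f$-sparse subgraph with exactly $\sum_{v\in V(H)}f(v)-f(V(H))$ edges, and $f$-partition-connected if $e_H(P)\ge\sum_{A\in P}f(A)-f(V(H))$ for every partition $P$ of $V(H)$ (with $f$ restricted to subsets of $V(H)$). -}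

module Defs where

open import Data.Bool using (Bool; true; false; _∧_)
open import Data.Nat using (ℕ)
open import Data.Integer using (ℤ; +_; _+_; _-_; _≤_)
open import Data.Fin using (Fin; _≟_)
open import Data.Fin.Subset using (Subset; ⁅_⁆; _∈_; _∉_; _⊆_; _∩_; _∪_; ∣_∣; ⊥)
open import Data.List using (List; foldr; map; filterᵇ; length; allFin)
open import Data.Vec using (lookup; tabulate)
open import Data.Product using (_×_; proj₁; proj₂; ∃; ∃-syntax)
open import Relation.Nullary using (¬_)
open import Relation.Nullary.Decidable using (⌊_⌋)
open import Relation.Binary.PropositionalEquality using (_≡_)

-- A graph on vertex set Fin n with m (labelled, possibly parallel) edges:
-- edge i has ends  proj₁ (end i)  and  proj₂ (end i).  Loopless is a hypothesis.
Ends : ℕ → ℕ → Set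
Ends n m = Fin m → Fin n × Fin n

Loopless : ∀ {n m} → Ends n m → Set
Loopless end = ∀ i → ¬ (proj₁ (end i) ≡ proj₂ (end i))

SetFn : ℕ → Set
SetFn n = Subset n → ℤ

ZeroOnEmpty : ∀ {n} → SetFn n → Set
ZeroOnEmpty f = f ⊥ ≡ + 0

Supermodular : ∀ {n} → ℕ → SetFn n → Set
Supermodular c f = ∀ A B → c Data.Nat.≤ ∣ A ∩ B ∣ → f A + f B ≤ f (A ∩ B) + f (A ∪ B)

Disjoint : ∀ {n} → Subset n → Subset n → Set
Disjoint A B = ∀ i → i ∈ A → i ∉ B

Subadditive : ∀ {n} → SetFn n → Set
Subadditive f = ∀ A B → Disjoint A B → f (A ∪ B) ≤ f A + f B

sumℤ : List ℤ → ℤ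
sumℤ = foldr _+_ (+ 0)

Σ∈ : ∀ {n} → Subset n → SetFn n → ℤ
Σ∈ {n} X f = sumℤ (map (λ v → f ⁅ v ⁆) (filterᵇ (λ v → lookup X v) (allFin n)))

eIn : ∀ {n m} → Ends n m → Subset m → Subset n → ℕ
eIn {m = m} end H X =
  length (filterᵇ (λ i → lookup H i ∧ (lookup X (proj₁ (end i)) ∧ lookup X (proj₂ (end i)))) (allFin m))

SparseOn : ∀ {n m} → Ends n m → SetFn n → Subset n → Subset m → Set
SparseOn end f A H = ∀ X → X ⊆ A → + (eIn end H X) ≤ Σ∈ X f - f X

-- spanning subgraph H of G (vertex set V(G) = all of Fin n) is f-sparse
Sparse : ∀ {n m} → Ends n m → SetFn n → Subset m → Set
Sparse end f H = ∀ X → + (eIn end H X) ≤ Σ∈ X f - f X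

Induced : ∀ {n m} → Ends n m → Subset m → Subset n → Subset m
Induced end H A = tabulate (λ i → lookup H i ∧ (lookup A (proj₁ (end i)) ∧ lookup A (proj₂ (end i))))

Rigid : ∀ {n m} → Ends n m → SetFn n → Subset n → Subset m → Set
Rigid end f A H = ∃[ S ] (S ⊆ Induced end H A × SparseOn end f A S × (+ ∣ S ∣ ≡ Σ∈ A f - f A))

-- a partition of A into k (nonempty) parts given by a labelling p;
-- part j is { v ∈ A | p v ≡ j }
Part : ∀ {n k} → Subset n → (Fin n → Fin k) → Fin k → Subset n
Part A p j = tabulate (λ v → lookup A v ∧ ⌊ p v ≟ j ⌋)

IsPartitionOf : ∀ {n k} → Subset n → (Fin n → Fin k) → Set
IsPartitionOf A p = ∀ j → ∃[ v ] (v ∈ Part A p j)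

eCross : ∀ {n m k} → Ends n m → Subset m → Subset n → (Fin n → Fin k) → ℕ
eCross {m = m} end H A p =
  length (filterᵇ (λ i → lookup (Induced end H A) i ∧ Data.Bool.not ⌊ p (proj₁ (end i)) ≟ p (proj₂ (end i)) ⌋) (allFin m))

PartitionConnected : ∀ {n m} → Ends n m → SetFn n → Subset n → Subset m → Set
PartitionConnected end f A H =
  ∀ k (p : Fin _ → Fin k) → IsPartitionOf A p →
  sumℤ (map (λ j → f (Part A p j)) (allFin k)) - f A ≤ + (eCross end H A p)

{-# OPTIONS --safe #-}
module Submission where

open import Defs
open import Data.Bool using (Bool; true; false; _∧_; _∨_; not; if_then_else_)
import Data.Bool.Properties as Bool
open import Data.Nat as ℕ using (ℕ; zero; suc; _≤_; s≤s; z≤n; _<_)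
import Data.Nat.Properties as ℕ
open import Data.Nat.Induction using (<-wellFounded)
open import Data.Integer as ℤ using (ℤ; 0ℤ; 1ℤ; +_; _+_; _-_)
import Data.Integer.Properties as ℤ
open import Data.Integer.Tactic.RingSolver using (solve-∀)
open import Data.Fin using (Fin; zero; suc; _≟_)
import Data.Fin.Properties as Fin
open import Data.Fin.Subset using (Subset; _∈_; _∉_; _⊆_; _∪_; _∩_; ∁; ∣_∣; ⊤; ⁅_⁆)
import Data.Fin.Subset.Properties as Sub
open import Data.List using (map; filterᵇ; length)
import Data.List as List
open import Data.Vec using ([]; _∷_; lookup; tabulate; _[_]≔_)
import Data.Vec.Properties as Vec
open import Data.Product using (_×_; _,_; proj₁; proj₂; ∃-syntax; Σ)
open import Data.Sum using (_⊎_; inj₁; inj₂)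
import Data.Sum as Sum
open import Function using (_∘_; id)
open import Relation.Nullary using (¬_; Dec; does; yes; no; contradiction; ¬?; _×-dec_; _⊎-dec_; _→-dec_)
open import Relation.Nullary.Decidable using (⌊_⌋; isYes≗does; toWitness; map′; decidable-stable; dec-true)
open import Relation.Unary using (Decidable)
open import Induction.WellFounded using (Acc; acc)
open import Relation.Binary.Definitions using (DecidableEquality)
open import Relation.Binary.PropositionalEquality using (_≡_; _≢_; _≗_; refl; sym; trans; cong; cong₂; subst; subst₂)
open import Algebra.Properties.CommutativeMonoid.Sum ℤ.+-0-commutativeMonoid using (sum; sum-cong-≗; ∑-distrib-+; ∑-comm; sum-replicate-zero)

-- A set X is tight for a sparse H when e_H(X) attains its bound; tight sets that meet enough are closed under ∩ and ∪,
-- and no edge of H joins the two differences.  Hence the fundamental circuit of an edge e ∉ H consists of e and the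
-- edges of H inside the least tight set containing the ends of e, whenever H + e is not sparse.
--
-- Search alternately from the uncovered edges, adding the fundamental circuits in F and in 𝓕 of all edges found.
-- By maximality no edge found can be added to F or 𝓕, so the set R of found edges is spanned by F ∩ R and by 𝓕 ∩ R.
-- The parts are the maximal F-tight sets whose F-edges all lie in R.  Tight sets of F are l-partition-connected.  Edges
-- of R outside F, in particular those of 𝓕 ∩ R, do not cross the parts, so the least 𝓕-tight set of an edge inside a
-- part A meets A in a set that is tight by subadditivity of ℓ.

-- Finite sums of integers

-- If `x` were smaller than `a`, the sums would differ strictly. All uncrossing arguments below end
-- this way: two bounds that are attained in sum are attained separately.
≤-squeezeˡ : ∀ {a b x y : ℤ} → x ℤ.≤ a → y ℤ.≤ b → a + b ℤ.≤ x + y → x ≡ a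
≤-squeezeˡ x≤a y≤b a+b≤x+y = ℤ.≤-antisym x≤a
  (ℤ.≮⇒≥ λ x<a → ℤ.<⇒≱ (ℤ.+-mono-<-≤ x<a y≤b) a+b≤x+y)

≤-squeezeʳ : ∀ {a b x y : ℤ} → x ℤ.≤ a → y ℤ.≤ b → a + b ℤ.≤ x + y → y ≡ b
≤-squeezeʳ {a} {b} {x} {y} x≤a y≤b a+b≤x+y =
  ≤-squeezeˡ y≤b x≤a (subst₂ ℤ._≤_ (ℤ.+-comm a b) (ℤ.+-comm x y) a+b≤x+y)

+-‿-interchange : ∀ a b c d → (a + b) - (c + d) ≡ (a - c) + (b - d)
+-‿-interchange = solve-∀

i+1≡j⇒i<j : ∀ {i j} → i + 1ℤ ≡ j → i ℤ.< j
i+1≡j⇒i<j {i} eq = ℤ.suc[i]≤j⇒i<j (ℤ.≤-reflexive (trans (ℤ.+-comm 1ℤ i) eq))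

sum-mono-≤ : ∀ {k} {f g : Fin k → ℤ} → (∀ i → f i ℤ.≤ g i) → sum f ℤ.≤ sum g
sum-mono-≤ {zero}  f≤g = ℤ.≤-refl
sum-mono-≤ {suc k} f≤g = ℤ.+-mono-≤ (f≤g zero) (sum-mono-≤ (f≤g ∘ suc))

sum-squeeze : ∀ {k} {f g : Fin k → ℤ} → (∀ i → f i ℤ.≤ g i) → sum g ℤ.≤ sum f → f ≗ g
sum-squeeze f≤g Σg≤Σf zero    = ≤-squeezeˡ (f≤g zero) (sum-mono-≤ (f≤g ∘ suc)) Σg≤Σf
sum-squeeze f≤g Σg≤Σf (suc i) = sum-squeeze (f≤g ∘ suc)
  (ℤ.≤-reflexive (sym (≤-squeezeʳ (f≤g zero) (sum-mono-≤ (f≤g ∘ suc)) Σg≤Σf))) i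

-- Written without subtraction: each side is completed by the summand at `e` that the other side
-- has.
sum-agree-off : ∀ {k} {f g : Fin k → ℤ} e → (∀ i → i ≢ e → f i ≡ g i) → sum f + g e ≡ sum g + f e
sum-agree-off {f = f} {g} zero f≈g
  rewrite sum-cong-≗ {x = f ∘ suc} {y = g ∘ suc} (λ i → f≈g (suc i) λ ()) = lemma (f zero) (sum (g ∘ suc)) (g zero)
  where
  lemma : ∀ a b c → a + b + c ≡ c + b + a
  lemma = solve-∀
sum-agree-off {f = f} {g} (suc e) f≈g
  rewrite f≈g zero (λ ()) = trans (ℤ.+-assoc (g zero) _ _) (trans
    (cong (λ s → g zero + s) (sum-agree-off e λ i i≢e → f≈g (suc i) (i≢e ∘ Fin.suc-injective)))
    (sym (ℤ.+-assoc (g zero) _ _)))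

sum-single : ∀ {k} {f : Fin k → ℤ} e → (∀ i → i ≢ e → f i ≡ 0ℤ) → sum f ≡ f e
sum-single {k} {f} e f≈0 = trans (sym (ℤ.+-identityʳ _))
  (trans (sum-agree-off e f≈0) (trans (cong (_+ f e) (sum-replicate-zero k)) (ℤ.+-identityˡ _)))

infix 8 [_]∙_
-- An Iverson bracket with a weight. It turns edge counts and vertex sums alike into `sum` over
-- `Fin`, where they can be compared term by term.
[_]∙_ : Bool → ℤ → ℤ
[ b ]∙ w = if b then w else 0ℤ

length-filterᵇ : ∀ {A : Set} {k} (P : A → Bool) (g : Fin k → A) →
                 + length (filterᵇ P (List.tabulate g)) ≡ sum (λ i → [ P (g i) ]∙ 1ℤ)
length-filterᵇ {k = zero}  P g = refl
length-filterᵇ {k = suc k} P g with P (g zero)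
... | true  = cong (λ s → 1ℤ + s) (length-filterᵇ P (g ∘ suc))
... | false = trans (length-filterᵇ P (g ∘ suc)) (sym (ℤ.+-identityˡ _))

sumℤ-filterᵇ : ∀ {A : Set} {k} (P : A → Bool) (w : A → ℤ) (g : Fin k → A) →
               sumℤ (map w (filterᵇ P (List.tabulate g))) ≡ sum (λ i → [ P (g i) ]∙ w (g i))
sumℤ-filterᵇ {k = zero}  P w g = refl
sumℤ-filterᵇ {k = suc k} P w g with P (g zero)
... | true  = cong (λ s → w (g zero) + s) (sumℤ-filterᵇ P w (g ∘ suc))
... | false = trans (sumℤ-filterᵇ P w (g ∘ suc)) (sym (ℤ.+-identityˡ _))

sumℤ-tabulate : ∀ {A : Set} {k} (w : A → ℤ) (g : Fin k → A) →
                sumℤ (map w (List.tabulate g)) ≡ sum (w ∘ g)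
sumℤ-tabulate {k = zero}  w g = refl
sumℤ-tabulate {k = suc k} w g = cong (λ s → w (g zero) + s) (sumℤ-tabulate w (g ∘ suc))

∣∣-sum : ∀ {k} (S : Subset k) → + ∣ S ∣ ≡ sum (λ i → [ lookup S i ]∙ 1ℤ)
∣∣-sum [] = refl
∣∣-sum (true ∷ S) = cong (λ s → 1ℤ + s) (∣∣-sum S)
∣∣-sum (false ∷ S) = trans (∣∣-sum S) (sym (ℤ.+-identityˡ _))

-- Serves to settle the inequalities for a single edge by evaluating all truth assignments.
∀Bool? : {P : Bool → Set} → (∀ b → Dec (P b)) → Dec (∀ b → P b)
∀Bool? {P} P? = map′ (λ (t , f) → λ { true → t ; false → f }) (λ p → p true , p false) (P? true ×-dec P? false)

-- Finite sets

lookup-∩ : ∀ {k} (A B : Subset k) v → lookup (A ∩ B) v ≡ lookup A v ∧ lookup B v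
lookup-∩ A B v = Vec.lookup-zipWith _∧_ v A B

lookup-∪ : ∀ {k} (A B : Subset k) v → lookup (A ∪ B) v ≡ lookup A v ∨ lookup B v
lookup-∪ A B v = Vec.lookup-zipWith _∨_ v A B

∈⇒lookup : ∀ {k} {A : Subset k} {v} → v ∈ A → lookup A v ≡ true
∈⇒lookup = Vec.[]=⇒lookup

lookup⇒∈ : ∀ {k} {A : Subset k} {v} → lookup A v ≡ true → v ∈ A
lookup⇒∈ = Vec.lookup⇒[]= _ _

∈-inserted : ∀ {k} (F : Subset k) {e} → e ∈ F [ e ]≔ true
∈-inserted F {e} = lookup⇒∈ (Vec.lookup∘update e F true)

∈-insert⁻ : ∀ {k} (F : Subset k) {e i} → i ∈ F [ e ]≔ true → i ≡ e ⊎ i ∈ F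
∈-insert⁻ F {e} {i} i∈ with i ≟ e
... | yes i≡e = inj₁ i≡e
... | no i≢e  = inj₂ (lookup⇒∈ (trans (sym (Vec.lookup∘update′ i≢e F true)) (∈⇒lookup i∈)))

∈-insert⁺ : ∀ {k} {F : Subset k} {e i} → i ∈ F → i ∈ F [ e ]≔ true
∈-insert⁺ {F = F} {e} {i} i∈ with i ≟ e
... | yes refl = ∈-inserted F
... | no i≢e   = lookup⇒∈ (trans (Vec.lookup∘update′ i≢e F true) (∈⇒lookup i∈))

∈-delete⁻ : ∀ {k} (F : Subset k) {e i} → i ∈ F [ e ]≔ false → i ≢ e × i ∈ F
∈-delete⁻ F {e} {i} i∈ with i ≟ e
... | yes refl = contradiction (trans (sym (Vec.lookup∘update e F false)) (∈⇒lookup i∈)) λ ()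
... | no i≢e   = i≢e , lookup⇒∈ (trans (sym (Vec.lookup∘update′ i≢e F false)) (∈⇒lookup i∈))

∈-delete⁺ : ∀ {k} {F : Subset k} {e i} → i ≢ e → i ∈ F → i ∈ F [ e ]≔ false
∈-delete⁺ {F = F} i≢e i∈ = lookup⇒∈ (trans (Vec.lookup∘update′ i≢e F false) (∈⇒lookup i∈))

∈⇒1≤∣∣ : ∀ {k} {A : Subset k} {v} → v ∈ A → 1 ≤ ∣ A ∣
∈⇒1≤∣∣ {A = A} {v} v∈A = subst (_≤ ∣ A ∣) (Sub.∣⁅x⁆∣≡1 v)
  (Sub.p⊆q⇒∣p∣≤∣q∣ λ x∈ → subst (_∈ A) (sym (Sub.x∈⁅y⁆⇒x≡y v x∈)) v∈A)

∈∧∈⇒2≤∣∣ : ∀ {k} {A : Subset k} {v w} → v ≢ w → v ∈ A → w ∈ A → 2 ≤ ∣ A ∣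
∈∧∈⇒2≤∣∣ {A = A} {v} {w} v≢w v∈A w∈A = subst (λ s → suc s ≤ ∣ A ∣) (Sub.∣⁅x⁆∣≡1 v)
  (Sub.p⊂q⇒∣p∣<∣q∣ ((λ x∈ → subst (_∈ A) (sym (Sub.x∈⁅y⁆⇒x≡y v x∈)) v∈A)
                  , w , w∈A , λ w∈ → v≢w (sym (Sub.x∈⁅y⁆⇒x≡y v w∈))))

⊈⇒∃ : ∀ {k} {A B : Subset k} → ¬ (A ⊆ B) → ∃[ v ] (v ∈ A × v ∉ B)
⊈⇒∃ {A = A} {B} A⊈B with Fin.any? (λ v → (v Sub.∈? A) ×-dec ¬? (v Sub.∈? B))
... | yes w  = w
... | no ∄w = contradiction (λ {v} v∈A → decidable-stable (v Sub.∈? B) λ v∉B → ∄w (v , v∈A , v∉B)) A⊈B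

module _ {k} {Q : Subset k → Set} (Q? : Decidable Q) where

  -- Descent on cardinality: a member `B` that does not contain the current set `A` yields the
  -- strictly smaller member `A ∩ B`.
  ∩-closed⇒least : (∀ {A B} → Q A → Q B → Q (A ∩ B)) → ∀ {A} → Q A →
                   ∃[ M ] (Q M × ∀ B → Q B → M ⊆ B)
  ∩-closed⇒least ∩-closed {A} QA = go A QA (<-wellFounded _)
    where
    go : ∀ A → Q A → Acc _<_ ∣ A ∣ → ∃[ M ] (Q M × ∀ B → Q B → M ⊆ B)
    go A QA (acc rec) with Sub.anySubset? (λ B → Q? B ×-dec ¬? (A Sub.⊆? B))
    ... | no ∄B = A , QA , λ B QB → decidable-stable (A Sub.⊆? B) λ A⊈B → ∄B (B , QB , A⊈B)
    ... | yes (B , QB , A⊈B) with v , v∈A , v∉B ← ⊈⇒∃ A⊈B =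
      go (A ∩ B) (∩-closed QA QB) (rec (Sub.p⊂q⇒∣p∣<∣q∣
        (Sub.p∩q⊆p A B , v , v∈A , v∉B ∘ proj₂ ∘ Sub.x∈p∩q⁻ A B)))

  ∪-closed⇒greatest : (∀ {A B} → Q A → Q B → Q (A ∪ B)) → ∀ {A} → Q A →
                      ∃[ M ] (Q M × ∀ B → Q B → B ⊆ M)
  ∪-closed⇒greatest ∪-closed {A} QA = go A QA (<-wellFounded _)
    where
    -- The set grows here, so the complement is what shrinks.
    go : ∀ A → Q A → Acc _<_ ∣ ∁ A ∣ → ∃[ M ] (Q M × ∀ B → Q B → B ⊆ M)
    go A QA (acc rec) with Sub.anySubset? (λ B → Q? B ×-dec ¬? (B Sub.⊆? A))
    ... | no ∄B = A , QA , λ B QB → decidable-stable (B Sub.⊆? A) λ B⊈A → ∄B (B , QB , B⊈A)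
    ... | yes (B , QB , B⊈A) with v , v∈B , v∉A ← ⊈⇒∃ B⊈A =
      go (A ∪ B) (∪-closed QA QB) (rec (Sub.p⊂q⇒∣p∣<∣q∣ (Sub.p⊂q⇒∁p⊃∁q
        (Sub.p⊆p∪q B , v , Sub.q⊆p∪q A B v∈B , v∉A))))

-- Every step that is not stationary adds one of only `k` elements.
increasing⇒stationary : ∀ {k} (P : ℕ → Fin k → Set) → (∀ i → Decidable (P i)) →
                        (∀ i e → P i e → P (suc i) e) → ∃[ i ] (∀ e → P (suc i) e → P i e)
-- Fuel `k` suffices: the size of the current set plus the fuel never drops below `k`, so growth
-- with no fuel left would exceed `k` elements.
increasing⇒stationary {k} P P? inc = go k 0 (ℕ.m≤n+m k _)
  where
  S : ℕ → Subset k
  S i = tabulate λ e → does (P? i e)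
  S⁺ : ∀ {i e} → P i e → e ∈ S i
  S⁺ {i} {e} p = lookup⇒∈ (trans (Vec.lookup∘tabulate _ e) (dec-true (P? i e) p))
  S⁻ : ∀ {i e} → e ∈ S i → P i e
  S⁻ {i} {e} e∈ with P? i e | trans (sym (Vec.lookup∘tabulate (λ e → does (P? i e)) e)) (∈⇒lookup e∈)
  ... | yes p | _ = p
  go : ∀ fuel i → k ≤ ∣ S i ∣ ℕ.+ fuel → ∃[ i ] (∀ e → P (suc i) e → P i e)
  go fuel i k≤ with S (suc i) Sub.⊆? S i
  ... | yes ⊆S = i , λ e p → S⁻ (⊆S (S⁺ p))
  ... | no ⊈S with v , v∈ , v∉ ← ⊈⇒∃ ⊈S =
    step fuel k≤ (Sub.p⊂q⇒∣p∣<∣q∣ {p = S i} {q = S (suc i)} (S⁺ ∘ inc i _ ∘ S⁻ , v , v∈ , v∉))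
    where
    step : ∀ fuel → k ≤ ∣ S i ∣ ℕ.+ fuel → ∣ S i ∣ < ∣ S (suc i) ∣ → ∃[ i ] (∀ e → P (suc i) e → P i e)
    step zero    k≤ lt = contradiction (ℕ.≤-trans lt (Sub.∣p∣≤n (S (suc i))))
                           (ℕ.≤⇒≯ (subst (k ≤_) (ℕ.+-identityʳ _) k≤))
    step (suc f) k≤ lt = go f (suc i) (ℕ.≤-trans (subst (k ≤_) (ℕ.+-suc _ f) k≤) (ℕ.+-monoˡ-≤ f lt))

-- Converts a labelling by arbitrary values, later by blocks, into the surjective numbering that
-- `IsPartitionOf` asks for. The value at `zero` either repeats a later one and takes over its
-- label, or receives a fresh label.
image-factorisation : ∀ {A : Set} → DecidableEquality A → ∀ {k} (B : Fin k → A) →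
  ∃[ r ] Σ (Fin k → Fin r) λ p →
    (∀ j → ∃[ v ] p v ≡ j) × (∀ v w → p v ≡ p w → B v ≡ B w) × (∀ v w → B v ≡ B w → p v ≡ p w)
image-factorisation _≟A_ {zero} B = 0 , (λ ()) , (λ ()) , (λ ()) , (λ ())
image-factorisation _≟A_ {suc k} B
  with r , p , onto , ker⁻ , ker⁺ ← image-factorisation _≟A_ (B ∘ suc)
  with Fin.any? (λ v → B zero ≟A B (suc v))
... | yes (v₀ , eq) = r , p′ , (λ j → suc (proj₁ (onto j)) , proj₂ (onto j)) , ker⁻′ , ker⁺′
  where
  p′ : Fin (suc k) → Fin r
  p′ zero    = p v₀
  p′ (suc v) = p v
  ker⁻′ : ∀ v w → p′ v ≡ p′ w → B v ≡ B w
  ker⁻′ zero    zero    _ = refl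
  ker⁻′ zero    (suc w) h = trans eq (ker⁻ v₀ w h)
  ker⁻′ (suc v) zero    h = trans (ker⁻ v v₀ h) (sym eq)
  ker⁻′ (suc v) (suc w) h = ker⁻ v w h
  ker⁺′ : ∀ v w → B v ≡ B w → p′ v ≡ p′ w
  ker⁺′ zero    zero    _ = refl
  ker⁺′ zero    (suc w) h = ker⁺ v₀ w (trans (sym eq) h)
  ker⁺′ (suc v) zero    h = ker⁺ v v₀ (trans h eq)
  ker⁺′ (suc v) (suc w) h = ker⁺ v w h
... | no new = suc r , p′ , onto′ , ker⁻′ , ker⁺′
  where
  p′ : Fin (suc k) → Fin (suc r)
  p′ zero    = zero
  p′ (suc v) = suc (p v)
  onto′ : ∀ j → ∃[ v ] p′ v ≡ j
  onto′ zero    = zero , refl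
  onto′ (suc j) = suc (proj₁ (onto j)) , cong suc (proj₂ (onto j))
  ker⁻′ : ∀ v w → p′ v ≡ p′ w → B v ≡ B w
  ker⁻′ zero    zero    _ = refl
  ker⁻′ (suc v) (suc w) h = ker⁻ v w (Fin.suc-injective h)
  ker⁺′ : ∀ v w → B v ≡ B w → p′ v ≡ p′ w
  ker⁺′ zero    zero    _ = refl
  ker⁺′ zero    (suc w) h = contradiction (w , h) new
  ker⁺′ (suc v) zero    h = contradiction (v , sym h) new
  ker⁺′ (suc v) (suc w) h = cong suc (ker⁺ v w h)

-- Tight sets of sparse edge sets

[]∙-≥0 : ∀ b → 0ℤ ℤ.≤ [ b ]∙ 1ℤ
[]∙-≥0 true  = ℤ.+≤+ z≤n
[]∙-≥0 false = ℤ.≤-refl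

sum-[]∙-≥0 : ∀ {k} (q : Fin k → Bool) → 0ℤ ℤ.≤ sum (λ i → [ q i ]∙ 1ℤ)
sum-[]∙-≥0 {k} q = ℤ.≤-trans (ℤ.≤-reflexive (sym (sum-replicate-zero k))) (sum-mono-≤ ([]∙-≥0 ∘ q))

Σ∈-sum : ∀ {n} (f : SetFn n) (X : Subset n) → Σ∈ X f ≡ sum (λ v → [ lookup X v ]∙ f ⁅ v ⁆)
Σ∈-sum f X = sumℤ-filterᵇ (lookup X) (λ v → f ⁅ v ⁆) id

[]∙-modular : ∀ a b w → [ a ∧ b ]∙ w + [ a ∨ b ]∙ w ≡ [ a ]∙ w + [ b ]∙ w
[]∙-modular true  true  w = refl
[]∙-modular true  false w = ℤ.+-comm 0ℤ w
[]∙-modular false b     w = refl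

Σ∈-modular : ∀ {n} (f : SetFn n) A B → Σ∈ (A ∩ B) f + Σ∈ (A ∪ B) f ≡ Σ∈ A f + Σ∈ B f
Σ∈-modular f A B
  rewrite Σ∈-sum f (A ∩ B) | Σ∈-sum f (A ∪ B) | Σ∈-sum f A | Σ∈-sum f B =
  trans (sym (∑-distrib-+ (λ v → [ lookup (A ∩ B) v ]∙ f ⁅ v ⁆) (λ v → [ lookup (A ∪ B) v ]∙ f ⁅ v ⁆)))
 (trans (sum-cong-≗ λ v → trans
          (cong₂ (λ a b → [ a ]∙ f ⁅ v ⁆ + [ b ]∙ f ⁅ v ⁆) (lookup-∩ A B v) (lookup-∪ A B v))
          ([]∙-modular (lookup A v) (lookup B v) (f ⁅ v ⁆)))
        (∑-distrib-+ (λ v → [ lookup A v ]∙ f ⁅ v ⁆) (λ v → [ lookup B v ]∙ f ⁅ v ⁆)))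

-- The vertex sum is modular, so subtracting the supermodular `f` leaves a submodular bound, for
-- sets that meet in at least `c` vertices.
slack-submodular : ∀ {n c} (f : SetFn n) → Supermodular c f → ∀ A B → c ≤ ∣ A ∩ B ∣ →
  (Σ∈ (A ∩ B) f - f (A ∩ B)) + (Σ∈ (A ∪ B) f - f (A ∪ B)) ℤ.≤ (Σ∈ A f - f A) + (Σ∈ B f - f B)
slack-submodular f super A B c≤ = subst₂ ℤ._≤_
  (+-‿-interchange (Σ∈ (A ∩ B) f) (Σ∈ (A ∪ B) f) (f (A ∩ B)) (f (A ∪ B)))
  (trans (cong (_- (f A + f B)) (Σ∈-modular f A B)) (+-‿-interchange (Σ∈ A f) (Σ∈ B f) (f A) (f B)))
  (ℤ.+-monoʳ-≤ (Σ∈ (A ∩ B) f + Σ∈ (A ∪ B) f) (ℤ.neg-mono-≤ (super A B c≤)))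

module _ {n m} (end : Ends n m) where

  bothEnds : Subset n → Fin m → Bool
  bothEnds X i = lookup X (proj₁ (end i)) ∧ lookup X (proj₂ (end i))

  Inside : Subset n → Fin m → Set
  Inside X i = proj₁ (end i) ∈ X × proj₂ (end i) ∈ X

  Inside? : ∀ X i → Dec (Inside X i)
  Inside? X i = (proj₁ (end i) Sub.∈? X) ×-dec (proj₂ (end i) Sub.∈? X)

  Inside⇒bothEnds : ∀ {X i} → Inside X i → bothEnds X i ≡ true
  Inside⇒bothEnds (a∈X , b∈X) = cong₂ _∧_ (∈⇒lookup a∈X) (∈⇒lookup b∈X)

  ¬Inside⇒bothEnds : ∀ {X i} → ¬ Inside X i → bothEnds X i ≡ false
  ¬Inside⇒bothEnds {X} {i} ∉X with lookup X (proj₁ (end i)) in eq₁ | lookup X (proj₂ (end i)) in eq₂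
  ... | true  | true  = contradiction (lookup⇒∈ eq₁ , lookup⇒∈ eq₂) ∉X
  ... | true  | false = refl
  ... | false | _     = refl

  Inside-∩⁺ : ∀ {A B i} → Inside A i → Inside B i → Inside (A ∩ B) i
  Inside-∩⁺ (a∈A , b∈A) (a∈B , b∈B) = Sub.x∈p∩q⁺ (a∈A , a∈B) , Sub.x∈p∩q⁺ (b∈A , b∈B)

  Inside-⊆ : ∀ {A B i} → A ⊆ B → Inside A i → Inside B i
  Inside-⊆ A⊆B (a∈A , b∈A) = A⊆B a∈A , A⊆B b∈A

  eIn-sum : ∀ H X → + eIn end H X ≡ sum (λ i → [ lookup H i ∧ bothEnds X i ]∙ 1ℤ)
  eIn-sum H X = length-filterᵇ (λ i → lookup H i ∧ bothEnds X i) id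

  -- One identity for insertion and deletion: the old contribution of `e` stands on the left, the
  -- new one on the right.
  eIn-update : ∀ H e b X → + eIn end (H [ e ]≔ b) X + [ lookup H e ∧ bothEnds X e ]∙ 1ℤ
                         ≡ + eIn end H X + [ b ∧ bothEnds X e ]∙ 1ℤ
  eIn-update H e b X rewrite eIn-sum (H [ e ]≔ b) X | eIn-sum H X =
    trans (sum-agree-off e λ i i≢e → cong (λ h → [ h ∧ bothEnds X i ]∙ 1ℤ) (Vec.lookup∘update′ i≢e H b))
          (cong (λ h → sum (λ i → [ lookup H i ∧ bothEnds X i ]∙ 1ℤ) + [ h ∧ bothEnds X e ]∙ 1ℤ) (Vec.lookup∘update e H b))

  edge-supermodular : ∀ h a a′ b b′ →
    [ h ∧ (a ∧ a′) ]∙ 1ℤ + [ h ∧ (b ∧ b′) ]∙ 1ℤ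
    ℤ.≤ [ h ∧ ((a ∧ b) ∧ (a′ ∧ b′)) ]∙ 1ℤ + [ h ∧ ((a ∨ b) ∧ (a′ ∨ b′)) ]∙ 1ℤ
  edge-supermodular = toWitness {a? = ∀Bool? λ h → ∀Bool? λ a → ∀Bool? λ a′ → ∀Bool? λ b → ∀Bool? λ b′ → _ ℤ.≤? _} _

  eIn-edge-supermodular : ∀ H A B i →
    [ lookup H i ∧ bothEnds A i ]∙ 1ℤ + [ lookup H i ∧ bothEnds B i ]∙ 1ℤ
    ℤ.≤ [ lookup H i ∧ bothEnds (A ∩ B) i ]∙ 1ℤ + [ lookup H i ∧ bothEnds (A ∪ B) i ]∙ 1ℤ
  eIn-edge-supermodular H A B i
    rewrite lookup-∩ A B (proj₁ (end i)) | lookup-∩ A B (proj₂ (end i))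
          | lookup-∪ A B (proj₁ (end i)) | lookup-∪ A B (proj₂ (end i)) =
    edge-supermodular (lookup H i) (lookup A (proj₁ (end i))) (lookup A (proj₂ (end i)))
      (lookup B (proj₁ (end i))) (lookup B (proj₂ (end i)))

  eIn-+-sum : ∀ H A B → + eIn end H A + + eIn end H B
    ≡ sum (λ i → [ lookup H i ∧ bothEnds A i ]∙ 1ℤ + [ lookup H i ∧ bothEnds B i ]∙ 1ℤ)
  eIn-+-sum H A B = trans (cong₂ _+_ (eIn-sum H A) (eIn-sum H B))
    (sym (∑-distrib-+ (λ i → [ lookup H i ∧ bothEnds A i ]∙ 1ℤ) (λ i → [ lookup H i ∧ bothEnds B i ]∙ 1ℤ)))

  eIn-supermodular : ∀ H A B →
    + eIn end H A + + eIn end H B ℤ.≤ + eIn end H (A ∩ B) + + eIn end H (A ∪ B)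
  eIn-supermodular H A B = subst₂ ℤ._≤_ (sym (eIn-+-sum H A B)) (sym (eIn-+-sum H (A ∩ B) (A ∪ B)))
    (sum-mono-≤ (eIn-edge-supermodular H A B))

  -- Equality of the sums forces equality at every edge. An edge of `H` inside the union but inside
  -- neither set would count 0 on one side and at least 1 on the other.
  eIn-modular⇒no-cross : ∀ H A B →
    + eIn end H (A ∩ B) + + eIn end H (A ∪ B) ℤ.≤ + eIn end H A + + eIn end H B →
    ∀ i → i ∈ H → Inside (A ∪ B) i → Inside A i ⊎ Inside B i
  eIn-modular⇒no-cross H A B le i i∈H in∪
    with Inside? A i | Inside? B i
  ... | yes inA | _       = inj₁ inA
  ... | no _    | yes inB = inj₂ inB
  ... | no ∉A   | no ∉B
    with sum-squeeze (eIn-edge-supermodular H A B) (subst₂ ℤ._≤_ (eIn-+-sum H (A ∩ B) (A ∪ B)) (eIn-+-sum H A B) le) i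
  ... | eq rewrite ∈⇒lookup i∈H | Inside⇒bothEnds in∪ | ¬Inside⇒bothEnds ∉A | ¬Inside⇒bothEnds ∉B
    with bothEnds (A ∩ B) i | eq
  ...   | true  | ()
  ...   | false | ()

  record Tight (f : SetFn n) (F : Subset m) (X : Subset n) : Set where
    constructor tight
    field count : + eIn end F X ≡ Σ∈ X f - f X
  open Tight

  Tight? : ∀ f F X → Dec (Tight f F X)
  Tight? f F X = map′ tight count (_ ℤ.≟ _)

  module _ {c f F} (super : Supermodular c f) (sparse : Sparse end f F)
           {A B} (tightA : Tight f F A) (tightB : Tight f F B) (c≤ : c ≤ ∣ A ∩ B ∣) where

    private
      slack≤ : (Σ∈ (A ∩ B) f - f (A ∩ B)) + (Σ∈ (A ∪ B) f - f (A ∪ B)) ℤ.≤ + eIn end F A + + eIn end F B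
      slack≤ = ℤ.≤-trans (slack-submodular f super A B c≤) (ℤ.≤-reflexive (sym (cong₂ _+_ (count tightA) (count tightB))))

    -- Uncrossing: the slacks of `A ∩ B` and `A ∪ B` sum to at most those of `A` and `B`, which
    -- equal the edge counts by tightness; these are at most the counts of `A ∩ B` and `A ∪ B`,
    -- which sparsity bounds by their slacks. So equality holds throughout.
    Tight-∩ : Tight f F (A ∩ B)
    Tight-∩ = tight (≤-squeezeˡ (sparse (A ∩ B)) (sparse (A ∪ B)) (ℤ.≤-trans slack≤ (eIn-supermodular F A B)))

    Tight-∪ : Tight f F (A ∪ B)
    Tight-∪ = tight (≤-squeezeʳ (sparse (A ∩ B)) (sparse (A ∪ B)) (ℤ.≤-trans slack≤ (eIn-supermodular F A B)))

    Tight-no-cross : ∀ i → i ∈ F → Inside (A ∪ B) i → Inside A i ⊎ Inside B i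
    Tight-no-cross = eIn-modular⇒no-cross F A B
      (ℤ.≤-trans (ℤ.+-mono-≤ (sparse (A ∩ B)) (sparse (A ∪ B))) slack≤)

  -- The slack of a singleton is zero, and a count is never negative.
  Tight-⁅⁆ : ∀ {f F} → Sparse end f F → ∀ v → Tight f F ⁅ v ⁆
  Tight-⁅⁆ {f} {F} sparse v = tight (ℤ.≤-antisym (sparse ⁅ v ⁆)
    (ℤ.≤-trans (ℤ.≤-reflexive slack≡0) (ℤ.+≤+ z≤n)))
    where
    Σ≡ : Σ∈ ⁅ v ⁆ f ≡ f ⁅ v ⁆
    Σ≡ = trans (Σ∈-sum f ⁅ v ⁆) (trans
      (sum-single v λ i i≢v → cong ([_]∙ f ⁅ i ⁆) (Bool.¬-not λ h → i≢v (Sub.x∈⁅y⁆⇒x≡y v (lookup⇒∈ h))))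
      (cong ([_]∙ f ⁅ v ⁆) (∈⇒lookup (Sub.x∈⁅x⁆ v))))
    slack≡0 : Σ∈ ⁅ v ⁆ f - f ⁅ v ⁆ ≡ 0ℤ
    slack≡0 = ℤ.i≡j⇒i-j≡0 Σ≡

  -- Rigidity and partition-connectivity of tight sets

  Tight⇒Rigid : ∀ {f F X} → Sparse end f F → Tight f F X → Rigid end f X F
  Tight⇒Rigid {f} {F} {X} sparse tightX =
    -- All of `F[X]` is the witness: it inherits sparsity from `F`, and tightness of `X` is the
    -- required number of edges.
    Induced end F X , id , (λ Y _ → ℤ.≤-trans (eIn≤ Y) (sparse Y)) , trans ∣∣≡ (count tightX)
    where
    lookup-Induced : ∀ i → lookup (Induced end F X) i ≡ lookup F i ∧ bothEnds X i
    lookup-Induced = Vec.lookup∘tabulate _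
    ∣∣≡ : + ∣ Induced end F X ∣ ≡ + eIn end F X
    ∣∣≡ = trans (∣∣-sum (Induced end F X)) (trans (sum-cong-≗ (cong ([_]∙ 1ℤ) ∘ lookup-Induced)) (sym (eIn-sum F X)))
    drop : ∀ h x y → [ (h ∧ x) ∧ y ]∙ 1ℤ ℤ.≤ [ h ∧ y ]∙ 1ℤ
    drop = toWitness {a? = ∀Bool? λ h → ∀Bool? λ x → ∀Bool? λ y → _ ℤ.≤? _} _
    eIn≤ : ∀ Y → + eIn end (Induced end F X) Y ℤ.≤ + eIn end F Y
    eIn≤ Y rewrite eIn-sum (Induced end F X) Y | eIn-sum F Y = sum-mono-≤ λ i →
      subst (λ h → [ h ∧ bothEnds Y i ]∙ 1ℤ ℤ.≤ [ lookup F i ∧ bothEnds Y i ]∙ 1ℤ) (sym (lookup-Induced i))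
        (drop (lookup F i) (bothEnds X i) (bothEnds Y i))

  module _ {k} (A : Subset n) (p : Fin n → Fin k) where

    private
      lookup-Part : ∀ j v → lookup (Part A p j) v ≡ lookup A v ∧ ⌊ p v ≟ j ⌋
      lookup-Part j = Vec.lookup∘tabulate _

    Σ∈-Part : ∀ f → Σ∈ A f ≡ sum (λ j → Σ∈ (Part A p j) f)
    Σ∈-Part f = trans (Σ∈-sum f A) (trans (sum-cong-≗ pointwise)
      (trans (∑-comm (λ v j → [ lookup A v ∧ ⌊ p v ≟ j ⌋ ]∙ f ⁅ v ⁆))
      (sum-cong-≗ λ j → sym (trans (Σ∈-sum f (Part A p j)) (sum-cong-≗ λ v → cong ([_]∙ f ⁅ v ⁆) (lookup-Part j v))))))
      where
      pointwise : ∀ v → [ lookup A v ]∙ f ⁅ v ⁆ ≡ sum (λ j → [ lookup A v ∧ ⌊ p v ≟ j ⌋ ]∙ f ⁅ v ⁆)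
      pointwise v = sym (trans (sum-single (p v) off) on)
        where
        off : ∀ j → j ≢ p v → [ lookup A v ∧ ⌊ p v ≟ j ⌋ ]∙ f ⁅ v ⁆ ≡ 0ℤ
        off j j≢ with p v ≟ j
        ... | yes eq = contradiction (sym eq) j≢
        ... | no _   = cong ([_]∙ f ⁅ v ⁆) (Bool.∧-zeroʳ (lookup A v))
        on : [ lookup A v ∧ ⌊ p v ≟ p v ⌋ ]∙ f ⁅ v ⁆ ≡ [ lookup A v ]∙ f ⁅ v ⁆
        on with p v ≟ p v
        ... | yes _ = cong ([_]∙ f ⁅ v ⁆) (Bool.∧-identityʳ (lookup A v))
        ... | no ≢  = contradiction refl ≢

    -- An edge inside `A` either crosses, or its ends share a label and it is counted in the part
    -- with that label.
    eIn-Part : ∀ H → + eIn end H A ℤ.≤ + eCross end H A p + sum (λ j → + eIn end H (Part A p j))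
    eIn-Part H = subst₂ ℤ._≤_ (sym (eIn-sum H A)) (sym rhs) (sum-mono-≤ λ i →
        edge (lookup H i) (lookup A (proj₁ (end i))) (lookup A (proj₂ (end i))) (p (proj₁ (end i))) (p (proj₂ (end i))))
      where
      inPart : Fin m → Fin k → Bool
      inPart i j = lookup H i ∧ ((lookup A (proj₁ (end i)) ∧ ⌊ p (proj₁ (end i)) ≟ j ⌋)
                               ∧ (lookup A (proj₂ (end i)) ∧ ⌊ p (proj₂ (end i)) ≟ j ⌋))
      crosses : Fin m → Bool
      crosses i = (lookup H i ∧ bothEnds A i) ∧ not ⌊ p (proj₁ (end i)) ≟ p (proj₂ (end i)) ⌋
      rhs : + eCross end H A p + sum (λ j → + eIn end H (Part A p j))
          ≡ sum (λ i → [ crosses i ]∙ 1ℤ + sum (λ j → [ inPart i j ]∙ 1ℤ))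
      rhs = trans (cong₂ _+_
              (trans (length-filterᵇ (λ i → lookup (Induced end H A) i ∧ not ⌊ p (proj₁ (end i)) ≟ p (proj₂ (end i)) ⌋) id)
                     (sum-cong-≗ λ i →
                       cong (λ h → [ h ∧ not ⌊ p (proj₁ (end i)) ≟ p (proj₂ (end i)) ⌋ ]∙ 1ℤ) (Vec.lookup∘tabulate _ i)))
              (trans (sum-cong-≗ λ j → trans (eIn-sum H (Part A p j))
                       (sum-cong-≗ λ i → cong₂ (λ a b → [ lookup H i ∧ (a ∧ b) ]∙ 1ℤ)
                         (lookup-Part j (proj₁ (end i))) (lookup-Part j (proj₂ (end i)))))
                     (∑-comm (λ j i → [ inPart i j ]∙ 1ℤ))))
            (sym (∑-distrib-+ (λ i → [ crosses i ]∙ 1ℤ) (λ i → sum (λ j → [ inPart i j ]∙ 1ℤ))))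
      edge : ∀ h a a′ (q r : Fin k) →
        [ h ∧ (a ∧ a′) ]∙ 1ℤ ℤ.≤
        [ (h ∧ (a ∧ a′)) ∧ not ⌊ q ≟ r ⌋ ]∙ 1ℤ + sum (λ j → [ h ∧ ((a ∧ ⌊ q ≟ j ⌋) ∧ (a′ ∧ ⌊ r ≟ j ⌋)) ]∙ 1ℤ)
      edge false a     a′    q r = ℤ.+-mono-≤ (ℤ.≤-refl {0ℤ}) (sum-[]∙-≥0 {k} λ _ → false)
      edge true  false a′    q r = ℤ.+-mono-≤ (ℤ.≤-refl {0ℤ}) (sum-[]∙-≥0 {k} λ _ → false)
      edge true  true  false q r = ℤ.+-mono-≤ (ℤ.≤-refl {0ℤ}) (sum-[]∙-≥0 λ j → ⌊ q ≟ j ⌋ ∧ false)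
      edge true  true  true  q r with q ≟ r
      ... | no _     = ℤ.+-mono-≤ (ℤ.≤-refl {1ℤ}) (sum-[]∙-≥0 λ j → ⌊ q ≟ j ⌋ ∧ ⌊ r ≟ j ⌋)
      ... | yes refl = ℤ.≤-reflexive (sym (trans (ℤ.+-identityˡ _) (trans (sum-single q off) on)))
        where
        off : ∀ j → j ≢ q → [ ⌊ q ≟ j ⌋ ∧ ⌊ q ≟ j ⌋ ]∙ 1ℤ ≡ 0ℤ
        off j j≢ with q ≟ j
        ... | yes eq = contradiction (sym eq) j≢
        ... | no _   = refl
        on : [ ⌊ q ≟ q ⌋ ∧ ⌊ q ≟ q ⌋ ]∙ 1ℤ ≡ 1ℤ
        on with q ≟ q
        ... | yes _ = refl
        ... | no ≢  = contradiction refl ≢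

  -- Tightness gives the number of edges inside `A`, and sparsity bounds those inside the parts. The
  -- vertex sums of the parts add up to that of `A` and cancel; what remains bounds the crossing
  -- edges from below.
  Tight⇒PartitionConnected : ∀ {f F A} → Sparse end f F → Tight f F A → PartitionConnected end f A F
  Tight⇒PartitionConnected {f} {F} {A} sparse tightA k p _
    rewrite sumℤ-tabulate (λ j → f (Part A p j)) id = begin
      W - f A                         ≡⟨ regroup W (f A) slack ⟩
      (slack + W - f A) - slack       ≡⟨ cong (λ u → (u - f A) - slack) slack+W ⟩
      (Σ∈ A f - f A) - slack          ≡⟨ cong (_- slack) (sym (count tightA)) ⟩
      + eIn end F A - slack           ≤⟨ ℤ.+-monoˡ-≤ (ℤ.- slack) eIn≤ ⟩
      + eCross end F A p + slack - slack ≡⟨ cancel (+ eCross end F A p) slack ⟩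
      + eCross end F A p ∎
    where
    open ℤ.≤-Reasoning
    W slack : ℤ
    W = sum (λ j → f (Part A p j))
    slack = sum (λ j → Σ∈ (Part A p j) f - f (Part A p j))
    eIn≤ : + eIn end F A ℤ.≤ + eCross end F A p + slack
    eIn≤ = ℤ.≤-trans (eIn-Part A p F)
      (ℤ.+-monoʳ-≤ (+ eCross end F A p) (sum-mono-≤ λ j → sparse (Part A p j)))
    slack+W : slack + W ≡ Σ∈ A f
    slack+W = trans (sym (∑-distrib-+ (λ j → Σ∈ (Part A p j) f - f (Part A p j)) (λ j → f (Part A p j))))
      (trans (sum-cong-≗ λ j → minus-plus (Σ∈ (Part A p j) f) (f (Part A p j))) (sym (Σ∈-Part A p f)))
      where
      minus-plus : ∀ a b → a - b + b ≡ a
      minus-plus = solve-∀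
    regroup : ∀ w a s → w - a ≡ (s + w - a) - s
    regroup = solve-∀
    cancel : ∀ c s → c + s - s ≡ c
    cancel = solve-∀

  -- Insertion, deletion and exchange of single edges

  eIn-insert : ∀ F e X → e ∉ F → + eIn end (F [ e ]≔ true) X ≡ + eIn end F X + [ bothEnds X e ]∙ 1ℤ
  eIn-insert F e X e∉F = trans (sym (ℤ.+-identityʳ _))
    (subst (λ h → + eIn end (F [ e ]≔ true) X + [ h ∧ bothEnds X e ]∙ 1ℤ ≡ + eIn end F X + [ bothEnds X e ]∙ 1ℤ)
      (Bool.¬-not (e∉F ∘ lookup⇒∈)) (eIn-update F e true X))

  eIn-delete : ∀ F e X → e ∈ F → + eIn end (F [ e ]≔ false) X + [ bothEnds X e ]∙ 1ℤ ≡ + eIn end F X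
  eIn-delete F e X e∈F = trans
    (subst (λ h → + eIn end (F [ e ]≔ false) X + [ h ∧ bothEnds X e ]∙ 1ℤ ≡ + eIn end F X + 0ℤ)
      (∈⇒lookup e∈F) (eIn-update F e false X))
    (ℤ.+-identityʳ _)

  eIn-delete-≤ : ∀ F e X → e ∈ F → + eIn end (F [ e ]≔ false) X ℤ.≤ + eIn end F X
  eIn-delete-≤ F e X e∈F = subst₂ ℤ._≤_ (ℤ.+-identityʳ _) (eIn-delete F e X e∈F)
    (ℤ.+-monoʳ-≤ (+ eIn end (F [ e ]≔ false) X) ([]∙-≥0 (bothEnds X e)))

  Sparse-delete : ∀ {f F e} → e ∈ F → Sparse end f F → Sparse end f (F [ e ]≔ false)
  Sparse-delete {F = F} {e} e∈F sparse X = ℤ.≤-trans (eIn-delete-≤ F e X e∈F) (sparse X)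

  -- The count with `e` lies between the count without `e` and the bound. If the latter two agree,
  -- `e` contributes nothing.
  Tight-delete : ∀ {f F e X} → e ∈ F → Sparse end f F → Tight f (F [ e ]≔ false) X →
                 Tight f F X × ¬ Inside X e
  Tight-delete {f} {F} {e} {X} e∈F sparse (tight eq) = tight eqF , notInside
    where
    eqF : + eIn end F X ≡ Σ∈ X f - f X
    eqF = ℤ.≤-antisym (sparse X) (ℤ.≤-trans (ℤ.≤-reflexive (sym eq)) (eIn-delete-≤ F e X e∈F))
    notInside : ¬ Inside X e
    notInside inX = ℤ.<-irrefl (trans eq (sym eqF)) (i+1≡j⇒i<j
      (subst (λ b → + eIn end (F [ e ]≔ false) X + [ b ]∙ 1ℤ ≡ + eIn end F X) (Inside⇒bothEnds inX) (eIn-delete F e X e∈F)))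

  -- Only sets containing both ends of `e` gain an edge, and by integrality a set that is not tight
  -- has room for one more.
  Sparse-insert : ∀ {f F e} → e ∉ F → Sparse end f F →
                  (∀ X → Tight f F X → ¬ Inside X e) → Sparse end f (F [ e ]≔ true)
  Sparse-insert {f} {F} {e} e∉F sparse free X = subst (ℤ._≤ Σ∈ X f - f X) (sym (eIn-insert F e X e∉F)) bound
    where
    bound : + eIn end F X + [ bothEnds X e ]∙ 1ℤ ℤ.≤ Σ∈ X f - f X
    bound with Inside? X e
    ... | no ∉X rewrite ¬Inside⇒bothEnds ∉X =
      subst (ℤ._≤ Σ∈ X f - f X) (sym (ℤ.+-identityʳ (+ eIn end F X))) (sparse X)
    ... | yes inX rewrite Inside⇒bothEnds inX =
      subst (ℤ._≤ Σ∈ X f - f X) (ℤ.+-comm 1ℤ (+ eIn end F X))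
        (ℤ.i<j⇒suc[i]≤j (ℤ.≤∧≢⇒< (sparse X) λ eq → free X (tight eq) inX))

  Sparse-insert⇒free : ∀ {f F e} → e ∉ F → Sparse end f (F [ e ]≔ true) →
                       ∀ {X} → Tight f F X → ¬ Inside X e
  Sparse-insert⇒free {f} {F} {e} e∉F sparse⁺ {X} (tight eq) inX = ℤ.<⇒≱
    (i+1≡j⇒i<j (subst (λ b → + eIn end F X + [ b ]∙ 1ℤ ≡ + eIn end (F [ e ]≔ true) X) (Inside⇒bothEnds inX)
      (sym (eIn-insert F e X e∉F))))
    (ℤ.≤-trans (sparse⁺ X) (ℤ.≤-reflexive (sym eq)))

  unaugmentable⇒Tight : ∀ {f F e} → e ∉ F → Sparse end f F → ¬ Sparse end f (F [ e ]≔ true) →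
                        ∃[ X ] (Tight f F X × Inside X e)
  unaugmentable⇒Tight {f} {F} {e} e∉F sparse ¬sparse⁺
    with Sub.anySubset? (λ X → Tight? f F X ×-dec Inside? X e)
  ... | yes w = w
  ... | no ∄X = contradiction (Sparse-insert e∉F sparse λ X t inX → ∄X (X , t , inX)) ¬sparse⁺

  -- For e ∉ F, the edges d ∈ F with  Forced f F e d  are those of the fundamental circuit of e.
  Forced : SetFn n → Subset m → Fin m → Fin m → Set
  Forced f F e d = ∀ X → Tight f F X → Inside X e → Inside X d

  Forced? : ∀ f F e d → Dec (Forced f F e d)
  Forced? f F e d = map′
    (λ ∄X X t inE → decidable-stable (Inside? X d) λ ∉X → ∄X (X , t , inE , ∉X))
    (λ forced (X , t , inE , ∉X) → ∉X (forced X t inE))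
    (¬? (Sub.anySubset? λ X → Tight? f F X ×-dec Inside? X e ×-dec ¬? (Inside? X d)))

  -- A tight set of `F - d` is tight for `F` and does not contain both ends of `d`. Since `d` is on
  -- the circuit of `e`, it does not contain both ends of `e` either.
  Sparse-exchange : ∀ {f F e d} → d ∈ F → e ∉ F [ d ]≔ false → Sparse end f F → Forced f F e d →
                    Sparse end f (F [ d ]≔ false [ e ]≔ true)
  Sparse-exchange {f} d∈F e∉F⁻ sparse forced = Sparse-insert e∉F⁻ (Sparse-delete {f} d∈F sparse) λ X tightX inX →
    let tightF , ∉X = Tight-delete d∈F sparse tightX in ∉X (forced X tightF inX)

  -- Matroid union: alternating search from the uncovered edges

  Reached : SetFn n → Subset m → (Fin m → Set) → Fin m → Set
  Reached f F P d = d ∈ F × ∃[ e ] (P e × e ∉ F × Forced f F e d)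

  -- The edges found within `i` rounds. Levels are cumulative, so they become stationary. Where no
  -- tight set surrounds an edge, `Forced` holds vacuously; `Level⇒unaugmentable` excludes this case
  -- for maximum pairs.
  Level : SetFn n → SetFn n → Subset m → Subset m → ℕ → Fin m → Set
  Level f g F G zero    e = e ∉ F × e ∉ G
  Level f g F G (suc i) e = Level f g F G i e ⊎ Reached f F (Level f g F G i) e ⊎ Reached g G (Level f g F G i) e

  Level? : ∀ f g F G i → Decidable (Level f g F G i)
  Level? f g F G zero    e = ¬? (e Sub.∈? F) ×-dec ¬? (e Sub.∈? G)
  Level? f g F G (suc i) e = Level? f g F G i e ⊎-dec reached? f F ⊎-dec reached? g G
    where
    reached? : ∀ h H → Dec (Reached h H (Level f g F G i) e)
    reached? h H = (e Sub.∈? H) ×-dec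
      Fin.any? λ d → Level? f g F G i d ×-dec ¬? (d Sub.∈? H) ×-dec Forced? h H d e

  Level-swap : ∀ {f g F G} i {e} → Level f g F G i e → Level g f G F i e
  Level-swap zero    (e∉F , e∉G) = e∉G , e∉F
  Level-swap (suc i) (inj₁ lev) = inj₁ (Level-swap i lev)
  Level-swap (suc i) (inj₂ (inj₁ (e∈F , d , lev , rest))) = inj₂ (inj₂ (e∈F , d , Level-swap i lev , rest))
  Level-swap (suc i) (inj₂ (inj₂ (e∈G , d , lev , rest))) = inj₂ (inj₁ (e∈G , d , Level-swap i lev , rest))

  uncovered⇒Level : ∀ {f g F G e} i → e ∉ F → e ∉ G → Level f g F G i e
  uncovered⇒Level zero    e∉F e∉G = e∉F , e∉G
  uncovered⇒Level (suc i) e∉F e∉G = inj₁ (uncovered⇒Level i e∉F e∉G)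

  record MaxPair (f g : SetFn n) (F G : Subset m) : Set where
    field
      disjoint : Disjoint F G
      sparseˡ  : Sparse end f F
      sparseʳ  : Sparse end g G
      maximum  : ∀ F′ G′ → Disjoint F′ G′ → Sparse end f F′ → Sparse end g G′ → ∣ F′ ∪ G′ ∣ ≤ ∣ F ∪ G ∣

  MaxPair-swap : ∀ {f g F G} → MaxPair f g F G → MaxPair g f G F
  MaxPair-swap {F = F} {G} pair = record
    { disjoint = λ i i∈G i∈F → disjoint i i∈F i∈G
    ; sparseˡ  = sparseʳ
    ; sparseʳ  = sparseˡ
    ; maximum  = λ G′ F′ dis sG sF → subst₂ _≤_ (cong ∣_∣ (Sub.∪-comm F′ G′)) (cong ∣_∣ (Sub.∪-comm F G))
                   (maximum F′ G′ (λ i i∈F i∈G → dis i i∈G i∈F) sF sG)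
    }
    where open MaxPair pair

  uncovered⇒unaugmentable : ∀ {f g F G e} → MaxPair f g F G → e ∉ F → e ∉ G →
                            ¬ Sparse end f (F [ e ]≔ true)
  uncovered⇒unaugmentable {f} {g} {F} {G} {e} pair e∉F e∉G sparse⁺ =
    ℕ.<⇒≱ (Sub.p⊂q⇒∣p∣<∣q∣ {p = F ∪ G} (F∪G⊆ , e , Sub.x∈p∪q⁺ (inj₁ (∈-inserted F)) , e∉F∪G))
          (maximum (F [ e ]≔ true) G dis sparse⁺ sparseʳ)
    where
    open MaxPair pair
    F∪G⊆ : F ∪ G ⊆ (F [ e ]≔ true) ∪ G
    F∪G⊆ = Sub.x∈p∪q⁺ ∘ Sum.map₁ ∈-insert⁺ ∘ Sub.x∈p∪q⁻ F G
    e∉F∪G : e ∉ F ∪ G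
    e∉F∪G = Sum.[ e∉F , e∉G ] ∘ Sub.x∈p∪q⁻ F G
    dis : Disjoint (F [ e ]≔ true) G
    dis i i∈F⁺ i∈G with ∈-insert⁻ F i∈F⁺
    ... | inj₁ refl = e∉G i∈G
    ... | inj₂ i∈F  = disjoint i i∈F i∈G

  -- Moving an edge from one member to the other does not shrink the union.
  MaxPair-shift : ∀ {f g F G e} → MaxPair f g F G → e ∈ G → Sparse end f (F [ e ]≔ true) →
                  MaxPair f g (F [ e ]≔ true) (G [ e ]≔ false)
  MaxPair-shift {g = g} {F} {G} {e} pair e∈G sparse⁺ = record
    { disjoint = dis
    ; sparseˡ  = sparse⁺
    ; sparseʳ  = Sparse-delete {g} e∈G sparseʳ
    ; maximum  = λ F′ G′ dis sF sG → ℕ.≤-trans (maximum F′ G′ dis sF sG) (Sub.p⊆q⇒∣p∣≤∣q∣ F∪G⊆)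
    }
    where
    open MaxPair pair
    dis : Disjoint (F [ e ]≔ true) (G [ e ]≔ false)
    dis i i∈F⁺ i∈G⁻ with ∈-insert⁻ F i∈F⁺ | ∈-delete⁻ G i∈G⁻
    ... | inj₁ i≡e | i≢e , _   = i≢e i≡e
    ... | inj₂ i∈F | _   , i∈G = disjoint i i∈F i∈G
    F∪G⊆ : F ∪ G ⊆ (F [ e ]≔ true) ∪ (G [ e ]≔ false)
    F∪G⊆ {i} i∈ with i ≟ e | Sub.x∈p∪q⁻ F G i∈
    ... | yes refl | _        = Sub.x∈p∪q⁺ (inj₁ (∈-inserted F))
    ... | no _     | inj₁ i∈F = Sub.x∈p∪q⁺ (inj₁ (∈-insert⁺ i∈F))
    ... | no i≢e   | inj₂ i∈G = Sub.x∈p∪q⁺ (inj₂ (∈-delete⁺ i≢e i∈G))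

  module _ (loopless : Loopless end) where

    2≤∣Inside∣ : ∀ {X e} → Inside X e → 2 ≤ ∣ X ∣
    2≤∣Inside∣ {e = e} (a∈X , b∈X) = ∈∧∈⇒2≤∣∣ (loopless e) a∈X b∈X

    -- A tight set around e′ certifies that the circuit of e′ avoids e, so it survives the insertion of e.
    Forced-insert : ∀ {f F e e′ d} → Supermodular 2 f → Sparse end f F → e ∉ F → Sparse end f (F [ e ]≔ true) →
                    e′ ∉ F → ¬ Sparse end f (F [ e′ ]≔ true) →
                    Forced f F e′ d → Forced f (F [ e ]≔ true) e′ d
    Forced-insert {f} {F} {e} {e′} super sparse e∉F sparse⁺ e′∉F ¬aug forced X tightX inX
      with T , tightT , inT ← unaugmentable⇒Tight {f} e′∉F sparse ¬aug =
      Inside-⊆ (Sub.p∩q⊆p X T) (forced (X ∩ T) tight∩ in∩)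
      where
      in∩ : Inside (X ∩ T) e′
      in∩ = Inside-∩⁺ inX inT
      e∉T : ¬ Inside T e
      e∉T = Sparse-insert⇒free e∉F sparse⁺ tightT
      same : ∀ {Y} → Y ⊆ T → + eIn end (F [ e ]≔ true) Y ≡ + eIn end F Y
      same {Y} Y⊆T = trans (eIn-insert F e Y e∉F)
        (trans (cong (λ b → + eIn end F Y + [ b ]∙ 1ℤ) (¬Inside⇒bothEnds (e∉T ∘ Inside-⊆ Y⊆T))) (ℤ.+-identityʳ _))
      -- Counts inside `T` ignore `e`, so `T` stays tight after the insertion. Uncrossing takes
      -- place in `F + e`, and its result is read back in `F`.
      tight∩ : Tight f F (X ∩ T)
      tight∩ = tight (trans (sym (same (Sub.p∩q⊆q X T)))
        (count (Tight-∩ super sparse⁺ tightX (tight (trans (same id) (count tightT))) (2≤∣Inside∣ in∩))))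

    module _ {f g F G e} (super : Supermodular 2 f) (pair : MaxPair f g F G)
             (e∉F : e ∉ F) (e∈G : e ∈ G) (sparse⁺ : Sparse end f (F [ e ]≔ true)) where
      open MaxPair pair

      -- The search up to level `i` does not meet `e`, so each of its steps can be repeated after
      -- `e` has moved from `G` to `F`. On the side of `F` this is `Forced-insert`.
      Level-shift : ∀ i → ¬ Level f g F G i e →
                    (∀ d → Level f g F G i d → d ∉ F → ¬ Sparse end f (F [ d ]≔ true)) →
                    ∀ d → Level f g F G i d → Level f g (F [ e ]≔ true) (G [ e ]≔ false) i d
      Level-shift i e∉L ¬aug d lev = go i e∉L ¬aug d lev
        where
        apart : ∀ i {d} → ¬ Level f g F G i e → Level f g F G i d → d ≢ e
        apart i e∉L lev d≡e = e∉L (subst (Level f g F G i) d≡e lev)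
        still∉F : ∀ {d} → d ≢ e → d ∉ F → d ∉ F [ e ]≔ true
        still∉F d≢e d∉F = Sum.[ d≢e , d∉F ] ∘ ∈-insert⁻ F
        still∉G : ∀ {d} → d ∉ G → d ∉ G [ e ]≔ false
        still∉G d∉G = d∉G ∘ proj₂ ∘ ∈-delete⁻ G
        go : ∀ i → ¬ Level f g F G i e →
             (∀ d → Level f g F G i d → d ∉ F → ¬ Sparse end f (F [ d ]≔ true)) →
             ∀ d → Level f g F G i d → Level f g (F [ e ]≔ true) (G [ e ]≔ false) i d
        go zero e∉L ¬aug d lev@(d∉F , d∉G) = still∉F (apart 0 e∉L lev) d∉F , still∉G d∉G
        go (suc i) e∉L ¬aug d (inj₁ lev) = inj₁ (go i (e∉L ∘ inj₁) (λ d → ¬aug d ∘ inj₁) d lev)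
        go (suc i) e∉L ¬aug d (inj₂ (inj₁ (d∈F , d′ , lev′ , d′∉F , forced))) = inj₂ (inj₁
          ( ∈-insert⁺ d∈F
          , d′ , go i (e∉L ∘ inj₁) (λ d → ¬aug d ∘ inj₁) d′ lev′
          , still∉F (apart i (e∉L ∘ inj₁) lev′) d′∉F
          , Forced-insert super sparseˡ e∉F sparse⁺ d′∉F (¬aug d′ (inj₁ lev′) d′∉F) forced))
        go (suc i) e∉L ¬aug d lev@(inj₂ (inj₂ (d∈G , d′ , lev′ , d′∉G , forced))) = inj₂ (inj₂
          ( ∈-delete⁺ (apart (suc i) e∉L lev) d∈G
          , d′ , go i (e∉L ∘ inj₁) (λ d → ¬aug d ∘ inj₁) d′ lev′
          , still∉G d′∉G
          -- Tight sets of `G - e` are tight for `G`, so fewer sets have to be checked.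
          , λ X tightX → forced X (proj₁ (Tight-delete e∈G sparseʳ tightX))))

    -- Otherwise e, reached from d, could be moved from G to F, making d augment G;
    -- but d still lies on the previous level for the shifted pair, which is maximum as well.
    Level⇒unaugmentable : ∀ i {f g F G} → Supermodular 2 f → Supermodular 2 g → MaxPair f g F G →
                          ∀ e → Level f g F G i e → e ∉ F → ¬ Sparse end f (F [ e ]≔ true)
    Level⇒unaugmentable zero superf superg pair e (_ , e∉G) e∉F = uncovered⇒unaugmentable pair e∉F e∉G
    Level⇒unaugmentable (suc i) {f} {g} {F} {G} superf superg pair e lev e∉F sparse⁺
      -- `Level-shift` needs `e` to be absent from level `i`; if it is present, induction applies
      -- directly.
      with Level? f g F G i e | lev
    ... | yes levᵢ | _         = Level⇒unaugmentable i superf superg pair e levᵢ e∉F sparse⁺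
    ... | no ¬levᵢ | inj₁ levᵢ = ¬levᵢ levᵢ
    ... | no ¬levᵢ | inj₂ (inj₁ (e∈F , _)) = e∉F e∈F
    ... | no ¬levᵢ | inj₂ (inj₂ (e∈G , d , levd , d∉G , forced)) =
      -- The pair changes and its members swap roles, but the level drops: the induction runs over
      -- all maximum pairs at once.
      Level⇒unaugmentable i superg superf (MaxPair-swap (MaxPair-shift pair e∈G sparse⁺)) d
        (Level-swap i (Level-shift superf pair e∉F e∈G sparse⁺ i ¬levᵢ (Level⇒unaugmentable i superf superg pair) d levd))
        d∉G⁻ (Sparse-exchange e∈G d∉G⁻ (MaxPair.sparseʳ pair) forced)
      where
      d∉G⁻ : d ∉ G [ e ]≔ false
      d∉G⁻ = d∉G ∘ proj₂ ∘ ∈-delete⁻ G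

    -- Tight sets around `e` share its two distinct ends, so `Tight-∩` applies. Every edge of `F`
    -- inside the least one is then forced by `e`.
    least-Tight : ∀ {f F e} → Supermodular 2 f → Sparse end f F → e ∉ F → ¬ Sparse end f (F [ e ]≔ true) →
                  ∃[ T ] ((Tight f F T × Inside T e) × ∀ X → Tight f F X × Inside X e → T ⊆ X)
    least-Tight {f} {F} {e} super sparse e∉F ¬aug =
      ∩-closed⇒least (λ X → Tight? f F X ×-dec Inside? X e)
        (λ (tA , inA) (tB , inB) → Tight-∩ super sparse tA tB (2≤∣Inside∣ (Inside-∩⁺ inA inB)) , Inside-∩⁺ inA inB)
        (proj₂ (unaugmentable⇒Tight e∉F sparse ¬aug))

    -- In matroid terms, `R` lies in the closure of `F ∩ R`; the tight set `T` certifies this for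
    -- `e`.
    Spanned : SetFn n → Subset m → (Fin m → Set) → Set
    Spanned f F R = ∀ e → R e → e ∉ F → ∃[ T ] (Tight f F T × Inside T e × ∀ d → d ∈ F → Inside T d → R d)

    -- `R` is a stationary level. The edges of `F` or `G` in the least tight set around a found edge
    -- would be found in the next round, so they belong to `R` already.
    matroid-union : ∀ {f g F G} → Supermodular 2 f → Supermodular 2 g → MaxPair f g F G →
      Σ (Fin m → Set) λ R → Decidable R × (∀ e → e ∉ F → e ∉ G → R e) × Spanned f F R × Spanned g G R
    matroid-union {f} {g} {F} {G} superf superg pair
      with i , stable ← increasing⇒stationary (Level f g F G) (Level? f g F G) (λ _ _ → inj₁) =
      Level f g F G i , Level? f g F G i , (λ e → uncovered⇒Level i) , spanF , spanG
      where
      open MaxPair pair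
      spanF : Spanned f F (Level f g F G i)
      spanF e lev e∉F
        with T , (tightT , inT) , least ← least-Tight superf sparseˡ e∉F (Level⇒unaugmentable i superf superg pair e lev e∉F) =
        T , tightT , inT , λ d d∈F dInT →
          stable d (inj₂ (inj₁ (d∈F , e , lev , e∉F , λ X tX inX → Inside-⊆ (least X (tX , inX)) dInT)))
      spanG : Spanned g G (Level f g F G i)
      spanG e lev e∉G
        with T , (tightT , inT) , least ← least-Tight superg sparseʳ e∉G
               (Level⇒unaugmentable i superg superf (MaxPair-swap pair) e (Level-swap i lev) e∉G) =
        T , tightT , inT , λ d d∈G dInT →
          stable d (inj₂ (inj₂ (d∈G , e , lev , e∉G , λ X tX inX → Inside-⊆ (least X (tX , inX)) dInT)))

  -- Restricting a tight set to a set that cuts none of its edges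

  module _ {f F} (subadd : Subadditive f) (sparse : Sparse end f F) where

    -- As no edge of `F` inside `X` joins `B` to its complement, the count of `X` splits over the
    -- two pieces. By subadditivity their slacks sum to at most that of `X`, so both bounds are
    -- attained. Unlike in `Tight-∩`, `B` itself may fail to be tight.
    Tight-restrict : ∀ {X} B → Tight f F X →
      (∀ d → d ∈ F → Inside X d → lookup B (proj₁ (end d)) ≡ lookup B (proj₂ (end d))) → Tight f F (X ∩ B)
    Tight-restrict {X} B (tight eqX) uncut = tight (≤-squeezeˡ (sparse (X ∩ B)) (sparse (X ∩ ∁ B))
      (ℤ.≤-trans slack≤ (ℤ.≤-trans (ℤ.≤-reflexive (sym eqX)) eIn≤)))
      where
      lookup-∩∁ : ∀ v → lookup (X ∩ ∁ B) v ≡ lookup X v ∧ not (lookup B v)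
      lookup-∩∁ v = trans (lookup-∩ X (∁ B) v) (cong (lookup X v ∧_) (Vec.lookup-map v not B))
      split : X ≡ (X ∩ B) ∪ (X ∩ ∁ B)
      split = trans (sym (Sub.∩-identityʳ X)) (trans (cong (X ∩_) (sym (Sub.∪-inverseʳ B))) (Sub.∩-distribˡ-∪ X B (∁ B)))
      separate : Disjoint (X ∩ B) (X ∩ ∁ B)
      separate v v∈ v∈∁ = Sub.x∈∁p⇒x∉p (proj₂ (Sub.x∈p∩q⁻ X (∁ B) v∈∁)) (proj₂ (Sub.x∈p∩q⁻ X B v∈))
      f≤ : f X ℤ.≤ f (X ∩ B) + f (X ∩ ∁ B)
      f≤ = subst (λ Y → f Y ℤ.≤ f (X ∩ B) + f (X ∩ ∁ B)) (sym split) (subadd (X ∩ B) (X ∩ ∁ B) separate)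
      []∙-split : ∀ x b w → [ x ∧ b ]∙ w + [ x ∧ not b ]∙ w ≡ [ x ]∙ w
      []∙-split false b     w = refl
      []∙-split true  true  w = ℤ.+-identityʳ w
      []∙-split true  false w = ℤ.+-identityˡ w
      Σ∈-split : Σ∈ (X ∩ B) f + Σ∈ (X ∩ ∁ B) f ≡ Σ∈ X f
      Σ∈-split = trans (cong₂ _+_ (Σ∈-sum f (X ∩ B)) (Σ∈-sum f (X ∩ ∁ B)))
        (trans (sym (∑-distrib-+ (λ v → [ lookup (X ∩ B) v ]∙ f ⁅ v ⁆) (λ v → [ lookup (X ∩ ∁ B) v ]∙ f ⁅ v ⁆)))
        (trans (sum-cong-≗ λ v → trans
            (cong₂ (λ a b → [ a ]∙ f ⁅ v ⁆ + [ b ]∙ f ⁅ v ⁆) (lookup-∩ X B v) (lookup-∩∁ v))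
            ([]∙-split (lookup X v) (lookup B v) (f ⁅ v ⁆)))
          (sym (Σ∈-sum f X))))
      slack≤ : (Σ∈ (X ∩ B) f - f (X ∩ B)) + (Σ∈ (X ∩ ∁ B) f - f (X ∩ ∁ B)) ℤ.≤ Σ∈ X f - f X
      slack≤ = subst₂ ℤ._≤_ (+-‿-interchange (Σ∈ (X ∩ B) f) (Σ∈ (X ∩ ∁ B) f) (f (X ∩ B)) (f (X ∩ ∁ B)))
        (cong (_- f X) Σ∈-split) (ℤ.+-monoʳ-≤ (Σ∈ (X ∩ B) f + Σ∈ (X ∩ ∁ B) f) (ℤ.neg-mono-≤ f≤))
      edge : ∀ h x x′ b → [ h ∧ (x ∧ x′) ]∙ 1ℤ
        ℤ.≤ [ h ∧ ((x ∧ b) ∧ (x′ ∧ b)) ]∙ 1ℤ + [ h ∧ ((x ∧ not b) ∧ (x′ ∧ not b)) ]∙ 1ℤ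
      edge = toWitness {a? = ∀Bool? λ h → ∀Bool? λ x → ∀Bool? λ x′ → ∀Bool? λ b → _ ℤ.≤? _} _
      outside : ∀ i → ¬ (i ∈ F × Inside X i) → lookup F i ∧ bothEnds X i ≡ false
      outside i ¬both with i Sub.∈? F
      ... | yes i∈F = trans (cong (lookup F i ∧_) (¬Inside⇒bothEnds λ inX → ¬both (i∈F , inX))) (Bool.∧-zeroʳ _)
      ... | no i∉F  = cong (_∧ bothEnds X i) (Bool.¬-not (i∉F ∘ lookup⇒∈))
      pointwise : ∀ i → [ lookup F i ∧ bothEnds X i ]∙ 1ℤ
        ℤ.≤ [ lookup F i ∧ bothEnds (X ∩ B) i ]∙ 1ℤ + [ lookup F i ∧ bothEnds (X ∩ ∁ B) i ]∙ 1ℤ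
      pointwise i with (i Sub.∈? F) ×-dec Inside? X i
      ... | yes (i∈F , inX)
        rewrite lookup-∩ X B (proj₁ (end i)) | lookup-∩ X B (proj₂ (end i))
              | lookup-∩∁ (proj₁ (end i)) | lookup-∩∁ (proj₂ (end i)) | uncut i i∈F inX =
        edge (lookup F i) (lookup X (proj₁ (end i))) (lookup X (proj₂ (end i))) (lookup B (proj₂ (end i)))
      ... | no ¬both rewrite outside i ¬both =
        ℤ.+-mono-≤ ([]∙-≥0 (lookup F i ∧ bothEnds (X ∩ B) i)) ([]∙-≥0 (lookup F i ∧ bothEnds (X ∩ ∁ B) i))
      eIn≤ : + eIn end F X ℤ.≤ + eIn end F (X ∩ B) + + eIn end F (X ∩ ∁ B)
      eIn≤ = subst₂ ℤ._≤_ (sym (eIn-sum F X)) (sym (eIn-+-sum F (X ∩ B) (X ∩ ∁ B))) (sum-mono-≤ pointwise)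

  -- The blocks of the partition

  module Blocks {f F} (super : Supermodular 1 f) (sparse : Sparse end f F)
                {R : Fin m → Set} (R? : Decidable R) where

    Reachable : Subset n → Set
    Reachable A = Tight f F A × ∀ d → d ∈ F → Inside A d → R d

    Reachable? : Decidable Reachable
    Reachable? A = Tight? f F A ×-dec Fin.all? λ d → (d Sub.∈? F) →-dec Inside? A d →-dec R? d

    -- The union acquires no new edge of `F`, by `Tight-no-cross`. For an intersecting supermodular
    -- function the common vertex `v` is overlap enough.
    Reachable-∪ : ∀ {A B v} → v ∈ A → v ∈ B → Reachable A → Reachable B → Reachable (A ∪ B)
    Reachable-∪ {A} {B} v∈A v∈B (tA , RA) (tB , RB) = Tight-∪ super sparse tA tB 1≤ ,
      λ d d∈F inAB → Sum.[ RA d d∈F , RB d d∈F ] (Tight-no-cross super sparse tA tB 1≤ d d∈F inAB)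
      where
      1≤ : 1 ≤ ∣ A ∩ B ∣
      1≤ = ∈⇒1≤∣∣ (Sub.x∈p∩q⁺ (v∈A , v∈B))

    module _ (loopless : Loopless end) where

      -- Without loops no edge lies inside a singleton. This starts the growth of a block at every
      -- vertex.
      Reachable-⁅⁆ : ∀ v → Reachable ⁅ v ⁆
      Reachable-⁅⁆ v = Tight-⁅⁆ sparse v , λ d _ (a∈ , b∈) →
        contradiction (trans (Sub.x∈⁅y⁆⇒x≡y v a∈) (sym (Sub.x∈⁅y⁆⇒x≡y v b∈))) (loopless d)

      abstract
        greatest : ∀ v → ∃[ B ] ((v ∈ B × Reachable B) × ∀ A → v ∈ A × Reachable A → A ⊆ B)
        greatest v = ∪-closed⇒greatest (λ A → (v Sub.∈? A) ×-dec Reachable? A)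
          (λ {A} {B} (v∈A , rA) (v∈B , rB) → Sub.p⊆p∪q B v∈A , Reachable-∪ v∈A v∈B rA rB)
          (Sub.x∈⁅x⁆ v , Reachable-⁅⁆ v)

      block : Fin n → Subset n
      block v = proj₁ (greatest v)

      ∈-block : ∀ v → v ∈ block v
      ∈-block v = proj₁ (proj₁ (proj₂ (greatest v)))

      block-Reachable : ∀ v → Reachable (block v)
      block-Reachable v = proj₂ (proj₁ (proj₂ (greatest v)))

      ⊆-block : ∀ {v A} → v ∈ A → Reachable A → A ⊆ block v
      ⊆-block {v} v∈A rA = proj₂ (proj₂ (greatest v)) _ (v∈A , rA)

      -- Each of the two blocks contains `A`, hence the other vertex, hence by maximality the other
      -- block. So blocks are equal or disjoint.
      block-≡ : ∀ {v w A} → Reachable A → v ∈ A → w ∈ A → block v ≡ block w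
      block-≡ {v} {w} rA v∈A w∈A = Sub.⊆-antisym
        (⊆-block (⊆-block v∈A rA w∈A) (block-Reachable v)) (⊆-block (⊆-block w∈A rA v∈A) (block-Reachable w))

      ∈-block⇒≡ : ∀ {v w} → w ∈ block v → block w ≡ block v
      ∈-block⇒≡ {v} w∈ = block-≡ (block-Reachable v) w∈ (∈-block v)

      ≡⇒∈-block : ∀ {v w} → block w ≡ block v → w ∈ block v
      ≡⇒∈-block {v} {w} eq = subst (w ∈_) eq (∈-block w)

-- The partition and its three properties

theorem5p1 : ∀ {n m : ℕ} (end : Ends n m) → Loopless end →
    (l ℓ : SetFn n) →
    ZeroOnEmpty l → Supermodular 1 l → Subadditive l →
    ZeroOnEmpty ℓ → Supermodular 2 ℓ → Subadditive ℓ →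
    (F 𝓕 : Subset m) → Disjoint F 𝓕 → Sparse end l F → Sparse end ℓ 𝓕 →
    (∀ (F′ 𝓕′ : Subset m) → Disjoint F′ 𝓕′ → Sparse end l F′ → Sparse end ℓ 𝓕′ →
    ∣ F′ ∪ 𝓕′ ∣ ≤ ∣ F ∪ 𝓕 ∣) →
    ∃[ k ] ∃[ p ]
    (IsPartitionOf {n} {k} ⊤ p
    × (∀ j → PartitionConnected end l (Part ⊤ p j) F)
    × (∀ i → lookup F i ≡ false → lookup 𝓕 i ≡ false →
    p (proj₁ (end i)) ≡ p (proj₂ (end i)))
    × (∀ i → lookup 𝓕 i ≡ false → p (proj₁ (end i)) ≡ p (proj₂ (end i)) →
    ∃[ X ] (X ⊆ Part ⊤ p (p (proj₁ (end i)))
    × proj₁ (end i) ∈ X × proj₂ (end i) ∈ X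
    × Rigid end ℓ X 𝓕)))
theorem5p1 {n} {m} end loopless l ℓ _ superl _ _ superℓ subaddℓ F 𝓕 disjoint sparseF sparse𝓕 maximum
  with R , R? , uncovered , spanF , span𝓕 ← matroid-union end loopless {l} {ℓ} {F} {𝓕}
         -- The search treats both functions as 2-intersecting; the full strength of `superl` enters
         -- through the blocks.
         (λ A B 2≤ → superl A B (ℕ.≤-trans (s≤s z≤n) 2≤)) superℓ
         (record { disjoint = disjoint ; sparseˡ = sparseF ; sparseʳ = sparse𝓕 ; maximum = maximum })
  with k , p , onto , ker⁻ , ker⁺ ← image-factorisation (Vec.≡-dec Bool._≟_)
         (Blocks.block end {F = F} superl sparseF R? loopless) =
  k , p , isPartition , connected
  , (λ i i∉F i∉𝓕 → ker⁺ _ _ (reached-in-block i (uncovered i (false⇒∉ i∉F) (false⇒∉ i∉𝓕)) (false⇒∉ i∉F)))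
  , λ i i∉𝓕 same → rigid i (false⇒∉ i∉𝓕) (ker⁻ _ _ same)
  where
  open Blocks end {F = F} superl sparseF R?
  B : Fin n → Subset n
  B = block loopless

  false⇒∉ : ∀ {H : Subset m} {i} → lookup H i ≡ false → i ∉ H
  false⇒∉ i∉H i∈H = contradiction (trans (sym i∉H) (∈⇒lookup i∈H)) λ ()

  lookup-Part : ∀ j v → lookup (Part ⊤ p j) v ≡ ⌊ p v ≟ j ⌋
  lookup-Part j v = trans (Vec.lookup∘tabulate _ v) (cong (_∧ ⌊ p v ≟ j ⌋) (∈⇒lookup (Sub.∈⊤ {x = v})))

  ∈-Part⁺ : ∀ {j v} → p v ≡ j → v ∈ Part ⊤ p j
  ∈-Part⁺ {j} {v} pv≡j = lookup⇒∈ (trans (lookup-Part j v) (trans (isYes≗does (p v ≟ j)) (dec-true (p v ≟ j) pv≡j)))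
  ∈-Part⁻ : ∀ {j v} → v ∈ Part ⊤ p j → p v ≡ j
  ∈-Part⁻ {j} {v} v∈ with p v ≟ j | trans (sym (lookup-Part j v)) (∈⇒lookup v∈)
  ... | yes eq | _ = eq

  Part-block : ∀ v → Part ⊤ p (p v) ≡ B v
  Part-block v = Sub.⊆-antisym
    (λ {w} w∈ → ≡⇒∈-block loopless (ker⁻ w v (∈-Part⁻ w∈)))
    (λ {w} w∈ → ∈-Part⁺ (ker⁺ w v (∈-block⇒≡ loopless w∈)))

  isPartition : IsPartitionOf ⊤ p
  isPartition j = proj₁ (onto j) , ∈-Part⁺ (proj₂ (onto j))

  connected : ∀ j → PartitionConnected end l (Part ⊤ p j) F
  connected j with v , refl ← onto j = subst (λ A → PartitionConnected end l A F) (sym (Part-block v))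
    (Tight⇒PartitionConnected end sparseF (proj₁ (block-Reachable loopless v)))

  -- The spanning set `T` of `d` is `Reachable`, so it lies in one block. This yields property (2),
  -- and also that edges of `𝓕` in `R` do not cross.
  reached-in-block : ∀ d → R d → d ∉ F → B (proj₁ (end d)) ≡ B (proj₂ (end d))
  reached-in-block d Rd d∉F with T , tightT , (a∈T , b∈T) , RT ← spanF d Rd d∉F =
    block-≡ loopless (tightT , RT) a∈T b∈T

  -- Edges of `F` inside a block belong to `R` by the choice of blocks, and uncovered edges start
  -- the search.
  in-block-reached : ∀ i → i ∉ 𝓕 → B (proj₁ (end i)) ≡ B (proj₂ (end i)) → R i
  in-block-reached i i∉𝓕 same with i Sub.∈? F
  ... | yes i∈F = proj₂ (block-Reachable loopless _) i i∈F (∈-block loopless _ , ≡⇒∈-block loopless (sym same))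
  ... | no i∉F  = uncovered i i∉F i∉𝓕

  rigid : ∀ i → i ∉ 𝓕 → B (proj₁ (end i)) ≡ B (proj₂ (end i)) →
    ∃[ X ] (X ⊆ Part ⊤ p (p (proj₁ (end i))) × proj₁ (end i) ∈ X × proj₂ (end i) ∈ X × Rigid end ℓ X 𝓕)
  rigid i i∉𝓕 same with X , tightX , (a∈X , b∈X) , RX ← span𝓕 i (in-block-reached i i∉𝓕 same) i∉𝓕 =
    -- `X` may extend beyond the block, so it is cut down to `A`. Its `𝓕`-edges lie in `R` and, by
    -- disjointness, outside `F`; hence none of them leaves a block, and the restriction stays
    -- tight.
    X ∩ A
    , (λ v∈ → subst (_ ∈_) (sym (Part-block a)) (proj₂ (Sub.x∈p∩q⁻ X A v∈)))
    , Sub.x∈p∩q⁺ (a∈X , a∈A) , Sub.x∈p∩q⁺ (b∈X , b∈A)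
    , Tight⇒Rigid end sparse𝓕 (Tight-restrict end subaddℓ sparse𝓕 A tightX
        λ d d∈𝓕 inX → uncut (reached-in-block d (RX d d∈𝓕 inX) λ d∈F → disjoint d d∈F d∈𝓕))
    where
    a : Fin n
    a = proj₁ (end i)
    A : Subset n
    A = B a
    a∈A : a ∈ A
    a∈A = ∈-block loopless a
    b∈A : proj₂ (end i) ∈ A
    b∈A = ≡⇒∈-block loopless (sym same)
    uncut : ∀ {v w} → B v ≡ B w → lookup A v ≡ lookup A w
    uncut {v} {w} eq with v Sub.∈? A | w Sub.∈? A
    ... | yes v∈A | yes w∈A = trans (∈⇒lookup v∈A) (sym (∈⇒lookup w∈A))
    ... | yes v∈A | no w∉A  = contradiction (≡⇒∈-block loopless (trans (sym eq) (∈-block⇒≡ loopless v∈A))) w∉A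
    ... | no v∉A  | yes w∈A = contradiction (≡⇒∈-block loopless (trans eq (∈-block⇒≡ loopless w∈A))) v∉A
    ... | no v∉A  | no w∉A  = trans (Bool.¬-not (v∉A ∘ lookup⇒∈)) (sym (Bool.¬-not (w∉A ∘ lookup⇒∈)))
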